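{- For the complete graph $K_n$, let $V(n)$ denote the number of distinct vertices visited by the random basic walk on $K_n$ (from any fixed starting vertex and initial port). Then, as $n\to\infty$, the expected value of $V(n)$ is asymptotically at least $(1-1/e)\,n$; that is, $\liminf_{n\to\infty} \mathbb{E}[V(n)]/n \ge 1-1/e$.
   Context: Each undirected edge $\{v,w\}$ is regarded as two arcs $v\to w$ and $w\to v$. A labeling of $K_n$ assigns, at each vertex $v$, the port numbers $1,\dots,n-1$ bijectively to the $n-1$ arcs leaving $v$ (labels on $v\to w$ and $w\to v$ need not agree). In a random labeling these bijections are chosen uniformly at random, independently for different vertices. Given a labeling, a starting vertex $v_0$ and an initial port $\ell$, the basic walk leaves $v_0$ along the arc labeled $\ell$; thereafter, whenever it enters a vertex $v$ along an arc whose label is $i$, it leaves $v$ along the arc out of $v$ labeled $(i \bmod (n-1))+1$. The random basic walk is the basic walk for a random labeling. -}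

module Defs where

open import Data.Nat.Base as ℕ using (ℕ; zero; suc; _∸_; _!)
import Data.Nat.Properties as ℕ
open import Data.Nat.DivMod using (_mod_)
import Data.Nat.Induction as ℕ
open import Data.Nat.Properties using (_!≢0)
open import Data.Integer.Base as ℤ using (ℤ; +_; +[1+_])
import Data.Integer.Properties as ℤ
open import Data.Rational.Base as ℚ using (ℚ; mkℚ; 0ℚ; 1ℚ; ½; _/_; _+_; _*_; _-_; -_; 1/_; ∣_∣; _≤_; _<_; NonZero; Positive; NonNegative; toℚᵘ)
open import Data.Rational.Properties as ℚ using (≤-refl; ≤-trans; +-mono-≤; +-monoʳ-≤)
open import Data.Rational.Solver using (module +-*-Solver)
import Data.Rational.Unnormalised.Base as ℚᵘ
import Data.Rational.Unnormalised.Properties as ℚᵘ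
open import Data.Fin.Base as Fin using (Fin; toℕ; fromℕ<; punchIn; punchOut; combine)
import Data.Fin.Properties as Fin
open import Data.List.Base using (List; []; _∷_; length; filter; map; allFin; cartesianProductWith)
open import Data.Nat.ListAction using (sum)
open import Data.List.Membership.Propositional using (_∈_)
open import Data.List.Membership.Propositional.Properties using (∈-allFin; ∈-cartesianProductWith⁺; ∈-filter⁺; ∈-filter⁻)
open import Data.List.Relation.Unary.Any using (here)
open import Data.List.Relation.Unary.All using ([])
open import Data.List.Relation.Unary.AllPairs using ([]; _∷_)
open import Data.List.Relation.Unary.Unique.Propositional using (Unique)
import Data.List.Relation.Unary.Unique.Propositional.Properties as Unique
open import Data.Vec.Base as Vec using (Vec; []; _∷_; lookup; tabulate)
open import Data.Vec.Properties using (∷-injective; lookup∘tabulate)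
open import Data.Product.Base using (∃; ∃₂; _×_; _,_; proj₁; proj₂)
open import Data.Sum.Base using (inj₁; inj₂)
open import Function.Base using (_∘_)
open import Relation.Nullary using (Dec; yes; no; ¬?)
open import Relation.Nullary.Decidable using (map′; _×-dec_; _→-dec_)
open import Relation.Binary.PropositionalEquality

-- Real numbers as Cauchy sequences of rationals; equality of reals is not _≡_.
record ℝ : Set where
  constructor mkℝ
  field
    approx : ℕ → ℚ
    cauchy : ∀ ε → 0ℚ < ε → ∃ λ N → ∀ m n → N ℕ.≤ m → N ℕ.≤ n → ∣ approx m - approx n ∣ ≤ ε

open ℝ public

infix 4 _≤ℝ_

_≤ℝ_ : ℝ → ℝ → Set
x ≤ℝ y = ∀ ε → 0ℚ < ε → ∃ λ N → ∀ n → N ℕ.≤ n → approx x n ≤ approx y n + ε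

fromℚ : ℚ → ℝ
fromℚ q = mkℝ (λ _ → q) λ ε 0<ε → 0 , λ _ _ _ _ →
  subst (λ z → ∣ z ∣ ≤ ε) (sym (ℚ.+-inverseʳ q)) (ℚ.<⇒≤ 0<ε)

private
  diff-swap : ∀ a b c d → (a - b) - (c - d) ≡ (a - c) + - (b - d)
  diff-swap = solve 4 (λ a b c d → ((a :- b) :- (c :- d)) := ((a :- c) :+ (:- (b :- d)))) refl
    where open +-*-Solver

  halves : ∀ ε → ½ * ε + ½ * ε ≡ ε
  halves ε = trans (sym (ℚ.*-distribʳ-+ ε ½ ½)) (ℚ.*-identityˡ ε)

  0<½* : ∀ {ε} → 0ℚ < ε → 0ℚ < ½ * ε
  0<½* {ε} 0<ε = subst (_< ½ * ε) (ℚ.*-zeroʳ ½) (ℚ.*-monoʳ-<-pos ½ 0<ε)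

infixl 6 _-ℝ_

_-ℝ_ : ℝ → ℝ → ℝ
x -ℝ y = mkℝ (λ n → approx x n - approx y n) cau
  where
  open ℚ.≤-Reasoning
  cau : ∀ ε → 0ℚ < ε → ∃ λ N → ∀ m n → N ℕ.≤ m → N ℕ.≤ n →
        ∣ (approx x m - approx y m) - (approx x n - approx y n) ∣ ≤ ε
  cau ε 0<ε with cauchy x (½ * ε) (0<½* 0<ε) | cauchy y (½ * ε) (0<½* 0<ε)
  ... | M , hx | N , hy = M ℕ.⊔ N , λ m n m≥ n≥ →
    let a = approx x m ; b = approx y m ; c = approx x n ; d = approx y n in begin
      ∣ (a - b) - (c - d) ∣        ≡⟨ cong ∣_∣ (diff-swap a b c d) ⟩
      ∣ (a - c) + - (b - d) ∣      ≤⟨ ℚ.∣p+q∣≤∣p∣+∣q∣ (a - c) (- (b - d)) ⟩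
      ∣ a - c ∣ + ∣ - (b - d) ∣    ≡⟨ cong (_+_ ∣ a - c ∣) (ℚ.∣-p∣≡∣p∣ (b - d)) ⟩
      ∣ a - c ∣ + ∣ b - d ∣        ≤⟨ +-mono-≤
        (hx m n (ℕ.m⊔n≤o⇒m≤o M N m≥) (ℕ.m⊔n≤o⇒m≤o M N n≥))
        (hy m n (ℕ.m⊔n≤o⇒n≤o M N m≥) (ℕ.m⊔n≤o⇒n≤o M N n≥)) ⟩
      ½ * ε + ½ * ε                ≡⟨ halves ε ⟩
      ε ∎

private
  1≤⇒pos : ∀ {q} → 1ℚ ≤ q → Positive q
  1≤⇒pos 1≤q = ℚ.positive (ℚ.<-≤-trans (ℚ.positive⁻¹ 1ℚ) 1≤q)

  1≤⇒nonZero : ∀ {q} → 1ℚ ≤ q → NonZero q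
  1≤⇒nonZero {q} 1≤q = ℚ.pos⇒nonZero q {{1≤⇒pos 1≤q}}

recip : ∀ q → 1ℚ ≤ q → ℚ
recip q 1≤q = (1/ q) {{1≤⇒nonZero 1≤q}}

private
  recip-pos : ∀ q (h : 1ℚ ≤ q) → Positive (recip q h)
  recip-pos q h = ℚ.1/pos⇒pos q {{1≤⇒pos h}}

  recip-nonNeg : ∀ q (h : 1ℚ ≤ q) → NonNegative (recip q h)
  recip-nonNeg q h = ℚ.pos⇒nonNeg (recip q h) {{recip-pos q h}}

  recip-invˡ : ∀ q (h : 1ℚ ≤ q) → recip q h * q ≡ 1ℚ
  recip-invˡ q h = ℚ.*-inverseˡ q {{1≤⇒nonZero h}}

  recip≤1 : ∀ q (h : 1ℚ ≤ q) → recip q h ≤ 1ℚ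
  recip≤1 q h = subst₂ _≤_ (ℚ.*-identityʳ (recip q h)) (recip-invˡ q h)
    (ℚ.*-monoˡ-≤-nonNeg (recip q h) {{recip-nonNeg q h}} h)

  recip-diff : ∀ p q (hp : 1ℚ ≤ p) (hq : 1ℚ ≤ q) →
               recip p hp - recip q hq ≡ - (p - q) * (recip p hp * recip q hq)
  recip-diff p q hp hq = sym (begin
      - (p - q) * (r * s)          ≡⟨ rearr p q r s ⟩
      (s * q) * r - (r * p) * s    ≡⟨ cong₂ (λ u v → u * r - v * s) (recip-invˡ q hq) (recip-invˡ p hp) ⟩
      1ℚ * r - 1ℚ * s              ≡⟨ cong₂ _-_ (ℚ.*-identityˡ r) (ℚ.*-identityˡ s) ⟩
      r - s ∎)
    where
    open ≡-Reasoning
    r = recip p hp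
    s = recip q hq
    rearr : ∀ p q r s → - (p - q) * (r * s) ≡ (s * q) * r - (r * p) * s
    rearr = solve 4 (λ p q r s → ((:- (p :- q)) :* (r :* s)) := (((s :* q) :* r) :- ((r :* p) :* s))) refl
      where open +-*-Solver

  recip-lipschitz : ∀ p q (hp : 1ℚ ≤ p) (hq : 1ℚ ≤ q) →
                    ∣ recip p hp - recip q hq ∣ ≤ ∣ p - q ∣
  recip-lipschitz p q hp hq = begin
      ∣ r - s ∣                      ≡⟨ cong ∣_∣ (recip-diff p q hp hq) ⟩
      ∣ - (p - q) * (r * s) ∣        ≡⟨ ℚ.∣p*q∣≡∣p∣*∣q∣ (- (p - q)) (r * s) ⟩
      ∣ - (p - q) ∣ * ∣ r * s ∣      ≡⟨ cong₂ _*_ (ℚ.∣-p∣≡∣p∣ (p - q)) (ℚ.0≤p⇒∣p∣≡p 0≤rs) ⟩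
      ∣ p - q ∣ * (r * s)            ≤⟨ ℚ.*-monoˡ-≤-nonNeg ∣ p - q ∣ {{ℚ.nonNegative (ℚ.0≤∣p∣ (p - q))}} rs≤1 ⟩
      ∣ p - q ∣ * 1ℚ                 ≡⟨ ℚ.*-identityʳ ∣ p - q ∣ ⟩
      ∣ p - q ∣ ∎
    where
    open ℚ.≤-Reasoning
    r = recip p hp
    s = recip q hq
    0≤rs : 0ℚ ≤ r * s
    0≤rs = subst (_≤ r * s) (ℚ.*-zeroʳ r)
      (ℚ.*-monoˡ-≤-nonNeg r {{recip-nonNeg p hp}} (ℚ.nonNegative⁻¹ s {{recip-nonNeg q hq}}))
    rs≤1 : r * s ≤ 1ℚ
    rs≤1 = ≤-trans (ℚ.*-monoˡ-≤-nonNeg r {{recip-nonNeg p hp}} (recip≤1 q hq))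
                   (subst (_≤ 1ℚ) (sym (ℚ.*-identityʳ r)) (recip≤1 p hp))

recipℝ : (x : ℝ) → (∀ n → 1ℚ ≤ approx x n) → ℝ
recipℝ x h = mkℝ (λ n → recip (approx x n) (h n)) λ ε 0<ε →
  let N , hx = cauchy x ε 0<ε in
  N , λ m n m≥ n≥ → ≤-trans (recip-lipschitz (approx x m) (approx x n) (h m) (h n)) (hx m n m≥ n≥)

1/! : ℕ → ℚ
1/! k = (+ 1 / (k !)) {{k !≢0}}

expSum : ℕ → ℚ
expSum zero    = 1/! zero
expSum (suc n) = expSum n + 1/! (suc n)

private
  ≃-unit : ∀ a → toℚᵘ (+ 1 / suc a) ℚᵘ.≃ ℚᵘ.mkℚᵘ (+ 1) a
  ≃-unit a = ℚ.toℚᵘ-fromℚᵘ (ℚᵘ.mkℚᵘ (+ 1) a)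

  unit-nonNeg : ∀ a .{{_ : ℕ.NonZero a}} → 0ℚ ≤ + 1 / a
  unit-nonNeg a = ℚ.nonNegative⁻¹ (+ 1 / a) {{ℚ.normalize-nonNeg 1 a}}

  unit-antimono : ∀ a b .{{_ : ℕ.NonZero a}} .{{_ : ℕ.NonZero b}} → b ℕ.≤ a → + 1 / a ≤ + 1 / b
  unit-antimono (suc a) (suc b) b≤a = ℚ.toℚᵘ-cancel-≤ (begin
      toℚᵘ (+ 1 / suc a)    ≃⟨ ≃-unit a ⟩
      ℚᵘ.mkℚᵘ (+ 1) a       ≤⟨ ℚᵘ.*≤* (ℤ.*-monoˡ-≤-nonNeg (+ 1) (ℤ.+≤+ b≤a)) ⟩
      ℚᵘ.mkℚᵘ (+ 1) b       ≃⟨ ≃-unit b ⟨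
      toℚᵘ (+ 1 / suc b)    ∎)
    where open ℚᵘ.≤-Reasoning

  unit-double : ∀ a b .{{_ : ℕ.NonZero a}} .{{_ : ℕ.NonZero b}} → b ℕ.+ b ℕ.≤ a →
                + 1 / a + + 1 / a ≤ + 1 / b
  unit-double (suc a) (suc b) h = ℚ.toℚᵘ-cancel-≤ (begin
      toℚᵘ (+ 1 / suc a + + 1 / suc a)             ≃⟨ ℚ.toℚᵘ-homo-+ (+ 1 / suc a) (+ 1 / suc a) ⟩
      toℚᵘ (+ 1 / suc a) ℚᵘ.+ toℚᵘ (+ 1 / suc a)   ≃⟨ ℚᵘ.+-cong (≃-unit a) (≃-unit a) ⟩
      ℚᵘ.mkℚᵘ (+ 1) a ℚᵘ.+ ℚᵘ.mkℚᵘ (+ 1) a         ≤⟨ ℚᵘ.*≤* (subst₂ ℤ._≤_ lhs rhs (ℤ.+≤+ key)) ⟩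
      ℚᵘ.mkℚᵘ (+ 1) b                              ≃⟨ ≃-unit b ⟨
      toℚᵘ (+ 1 / suc b)                           ∎)
    where
    open ℚᵘ.≤-Reasoning
    A = suc a
    B = suc b
    key : (A ℕ.+ A) ℕ.* B ℕ.≤ A ℕ.* A
    key = ℕ.≤-trans (ℕ.≤-reflexive (trans (ℕ.*-distribʳ-+ B A A) (sym (ℕ.*-distribˡ-+ A B B)))) (ℕ.*-monoʳ-≤ A h)
    lhs : + ((A ℕ.+ A) ℕ.* B) ≡ ((+ 1 ℤ.* + A) ℤ.+ (+ 1 ℤ.* + A)) ℤ.* + B
    lhs = trans (ℤ.pos-* (A ℕ.+ A) B) (cong (ℤ._* + B) (cong₂ ℤ._+_ (sym (ℤ.*-identityˡ (+ A))) (sym (ℤ.*-identityˡ (+ A)))))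
    rhs : + (A ℕ.* A) ≡ + 1 ℤ.* + (A ℕ.* A)
    rhs = sym (ℤ.*-identityˡ (+ (A ℕ.* A)))

  1/!-nonNeg : ∀ k → 0ℚ ≤ 1/! k
  1/!-nonNeg k = unit-nonNeg (k !) {{k !≢0}}

  p≤p+q : ∀ p {q} → 0ℚ ≤ q → p ≤ p + q
  p≤p+q p {q} 0≤q = subst (_≤ p + q) (ℚ.+-identityʳ p) (+-monoʳ-≤ p 0≤q)

  expSum-mono : ∀ {N n} → N ℕ.≤′ n → expSum N ≤ expSum n
  expSum-mono ℕ.≤′-refl = ≤-refl
  expSum-mono (ℕ.≤′-step {n} N≤n) = ≤-trans (expSum-mono N≤n) (p≤p+q (expSum n) (1/!-nonNeg (suc n)))

  1/!-double : ∀ k → 1/! (2 ℕ.+ k) + 1/! (2 ℕ.+ k) ≤ 1/! (1 ℕ.+ k)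
  1/!-double k = unit-double (suc (suc k) !) (suc k !) {{suc (suc k) !≢0}} {{suc k !≢0}}
    (ℕ.+-monoʳ-≤ (suc k !) (ℕ.m≤m+n (suc k !) (k ℕ.* suc k !)))

  expSum-upper : ∀ {N n} → suc N ℕ.≤′ n → expSum n + 1/! n ≤ expSum (suc N) + 1/! (suc N)
  expSum-upper ℕ.≤′-refl = ≤-refl
  expSum-upper (ℕ.≤′-step {zero} p) with ℕ.≤′⇒≤ p
  ... | ()
  expSum-upper (ℕ.≤′-step {suc n} p) = ≤-trans
    (subst (_≤ expSum (suc n) + 1/! (suc n))
      (sym (ℚ.+-assoc (expSum (suc n)) (1/! (2 ℕ.+ n)) (1/! (2 ℕ.+ n))))
      (+-monoʳ-≤ (expSum (suc n)) (1/!-double n)))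
    (expSum-upper p)

  n≤n! : ∀ n → n ℕ.≤ n !
  n≤n! zero    = ℕ.z≤n
  n≤n! (suc n) = ℕ.m≤m*n (suc n) (n !) {{n !≢0}}

  archimedean : ∀ ε → 0ℚ < ε → ∃ λ k → 1/! (suc k) ≤ ε
  archimedean ε@(mkℚ +[1+ a ] d _) 0<ε = d ,
    ≤-trans (unit-antimono (suc d !) (suc d) {{suc d !≢0}} (n≤n! (suc d)))
      (ℚ.toℚᵘ-cancel-≤ (ℚᵘ.≤-respˡ-≃ (ℚᵘ.≃-sym (≃-unit d))
        (ℚᵘ.*≤* (ℤ.*-monoʳ-≤-nonNeg (+ suc d) (ℤ.+≤+ (ℕ.s≤s (ℕ.z≤n {a})))))))
  archimedean (mkℚ (+ zero) d _) (ℚ.*<* (ℤ.+<+ ()))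
  archimedean (mkℚ ℤ.-[1+ _ ] d _) (ℚ.*<* ())

  ∣-∣≤ : ∀ {p q l u} → l ≤ p → l ≤ q → p ≤ u → q ≤ u → ∣ p - q ∣ ≤ u - l
  ∣-∣≤ {p} {q} {l} {u} l≤p l≤q p≤u q≤u with ℚ.∣p∣≡p∨∣p∣≡-p (p - q)
  ... | inj₁ eq = subst (_≤ u - l) (sym eq) (+-mono-≤ p≤u (ℚ.neg-antimono-≤ l≤q))
  ... | inj₂ eq = subst (_≤ u - l) (sym (trans eq (flip- p q))) (+-mono-≤ q≤u (ℚ.neg-antimono-≤ l≤p))
    where
    flip- : ∀ p q → - (p - q) ≡ q - p
    flip- = solve 2 (λ p q → (:- (p :- q)) := (q :- p)) refl where open +-*-Solver

  expSum-cauchy : ∀ ε → 0ℚ < ε → ∃ λ N → ∀ m n → N ℕ.≤ m → N ℕ.≤ n → ∣ expSum m - expSum n ∣ ≤ ε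
  expSum-cauchy ε 0<ε with archimedean ε 0<ε
  ... | k , h = suc k , λ m n m≥ n≥ → ≤-trans
      (∣-∣≤ (expSum-mono (ℕ.≤⇒≤′ m≥)) (expSum-mono (ℕ.≤⇒≤′ n≥)) (upper m m≥) (upper n n≥))
      (subst (_≤ ε) (sym (cancel (expSum (suc k)) (1/! (suc k)))) h)
    where
    upper : ∀ n → suc k ℕ.≤ n → expSum n ≤ expSum (suc k) + 1/! (suc k)
    upper n n≥ = ≤-trans (p≤p+q (expSum n) (1/!-nonNeg n)) (expSum-upper (ℕ.≤⇒≤′ n≥))
    cancel : ∀ a b → (a + b) - a ≡ b
    cancel = solve 2 (λ a b → ((a :+ b) :- a) := b) refl where open +-*-Solver

e : ℝ
e = mkℝ expSum expSum-cauchy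

1≤expSum : ∀ n → 1ℚ ≤ expSum n
1≤expSum n = expSum-mono (ℕ.≤⇒≤′ (ℕ.z≤n {n}))

1/e : ℝ
1/e = recipℝ e 1≤expSum

-- liminf aₙ ≥ L, without presupposing that the limit inferior exists
-- as a real number (constructively it need not).
Liminf_AtLeast_ : (ℕ → ℚ) → ℝ → Set
Liminf a AtLeast L = ∀ ε → 0ℚ < ε → ∃ λ N → ∀ n → N ℕ.≤ n → (L -ℝ fromℚ ε) ≤ℝ fromℚ (a n)

Vertex : ℕ → Set
Vertex n = Fin n

-- The element i of Port n stands for the port number toℕ i + 1.
Port : ℕ → Set
Port n = Fin (n ∸ 1)

-- Entry p of row v is the head w of the arc v → w that carries the label p.
Table : ℕ → Set
Table n = Vec (Vec (Vertex n) (n ∸ 1)) n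

target : ∀ {n} → Table n → Vertex n → Port n → Vertex n
target L v p = lookup (lookup L v) p

-- Row v is a bijection between the ports and the arcs leaving v, i.e. the
-- vertices other than v.
record IsLabelingAt {n} (L : Table n) (v : Vertex n) : Set where
  constructor isLabelingAt
  field
    loopless   : ∀ p → target L v p ≢ v
    injective  : ∀ p q → target L v p ≡ target L v q → p ≡ q
    surjective : ∀ w → w ≢ v → ∃ λ p → target L v p ≡ w

IsLabeling : ∀ {n} → Table n → Set
IsLabeling {n} L = ∀ (v : Vertex n) → IsLabelingAt L v

isLabeling? : ∀ {n} (L : Table n) → Dec (IsLabeling L)
isLabeling? L = Fin.all? λ v →
  map′ (λ { (a , b , c) → isLabelingAt a b c })
       (λ { (isLabelingAt a b c) → a , b , c })
       (Fin.all? (λ p → ¬? (target L v p Fin.≟ v))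
         ×-dec Fin.all? (λ p → Fin.all? λ q → (target L v p Fin.≟ target L v q) →-dec (p Fin.≟ q))
         ×-dec Fin.all? (λ w → ¬? (w Fin.≟ v) →-dec Fin.any? (λ p → target L v p Fin.≟ w)))

vecs : ∀ {A : Set} → List A → (k : ℕ) → List (Vec A k)
vecs xs zero    = [] ∷ []
vecs xs (suc k) = cartesianProductWith _∷_ xs (vecs xs k)

tables : (n : ℕ) → List (Table n)
tables n = vecs (vecs (allFin n) (n ∸ 1)) n

labelings : (n : ℕ) → List (Table n)
labelings n = filter isLabeling? (tables n)

∈-vecs : ∀ {A : Set} {xs : List A} → (∀ x → x ∈ xs) → ∀ {k} (v : Vec A k) → v ∈ vecs xs k
∈-vecs all []      = here refl
∈-vecs all (x ∷ v) = ∈-cartesianProductWith⁺ _∷_ (all x) (∈-vecs all v)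

vecs-unique : ∀ {A : Set} {xs : List A} → Unique xs → ∀ k → Unique (vecs xs k)
vecs-unique u zero    = [] ∷ []
vecs-unique u (suc k) = Unique.cartesianProductWith⁺ _∷_ ∷-injective u (vecs-unique u k)

labelings-complete : ∀ {n} (L : Table n) → IsLabeling L → L ∈ labelings n
labelings-complete L h = ∈-filter⁺ isLabeling? (∈-vecs (∈-vecs ∈-allFin) L) h

labelings-sound : ∀ {n} {L : Table n} → L ∈ labelings n → IsLabeling L
labelings-sound {n} L∈ = proj₂ (∈-filter⁻ isLabeling? {xs = tables n} L∈)

labelings-unique : ∀ n → Unique (labelings n)
labelings-unique n = Unique.filter⁺ isLabeling? (vecs-unique (vecs-unique (Unique.allFin⁺ n) (n ∸ 1)) n)

private
  someLabeling : ∀ n → ∃ λ (L : Table n) → IsLabeling L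
  someLabeling zero    = [] , λ ()
  someLabeling (suc m) = L , λ v → isLabelingAt
      (λ p eq → Fin.punchInᵢ≢i v p (trans (sym (L-eq v p)) eq))
      (λ p q eq → Fin.punchIn-injective v p q (trans (sym (L-eq v p)) (trans eq (L-eq v q))))
      (λ w w≢v → punchOut (w≢v ∘ sym) , trans (L-eq v _) (Fin.punchIn-punchOut (w≢v ∘ sym)))
    where
    L : Table (suc m)
    L = tabulate λ v → tabulate (punchIn v)
    L-eq : ∀ v p → target L v p ≡ punchIn v p
    L-eq v p = trans (cong (λ r → lookup r p) (lookup∘tabulate (λ v → tabulate (punchIn v)) v))
                     (lookup∘tabulate (punchIn v) p)

  ∈⇒nonZero : ∀ {A : Set} {x : A} {xs : List A} → x ∈ xs → ℕ.NonZero (length xs)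
  ∈⇒nonZero {xs = _ ∷ _} _ = _

labelings-nonEmpty : ∀ n → ℕ.NonZero (length (labelings n))
labelings-nonEmpty n = let L , h = someLabeling n in ∈⇒nonZero (labelings-complete L h)

-- With port numbers i = toℕ p + 1, the successor (i mod k) + 1 is
-- represented by i mod k.
nextPort : ∀ {k} → Fin k → Fin k
nextPort {k} p = (suc (toℕ p) mod k) {{Fin.nonZeroIndex p}}

-- (v , p): the walk is at v and is about to leave through port p.
State : ℕ → Set
State n = Vertex n × Port n

step : ∀ {n} → Table n → State n → State n
step L (v , p) = target L v p , nextPort p

state : ∀ {n} → Table n → Vertex n → Port n → ℕ → State n
state L v₀ ℓ zero    = v₀ , ℓ
state L v₀ ℓ (suc t) = step L (state L v₀ ℓ t)

basicWalk : ∀ {n} → Table n → Vertex n → Port n → ℕ → Vertex n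
basicWalk L v₀ ℓ t = proj₁ (state L v₀ ℓ t)

Visited : ∀ {n} → Table n → Vertex n → Port n → Vertex n → Set
Visited L v₀ ℓ w = ∃ λ t → basicWalk L v₀ ℓ t ≡ w

-- By pigeonhole the state sequence is eventually
-- periodic, and the times t ≤ n (n - 1) already exhaust it; Visited itself
-- ranges over all times.
module _ {n} (L : Table n) (v₀ : Vertex n) (ℓ : Port n) where
  private
    σ : ℕ → State n
    σ = state L v₀ ℓ

    size : ℕ
    size = n ℕ.* (n ∸ 1)

    code : State n → Fin size
    code (v , p) = combine v p

    code-injective : ∀ s s′ → code s ≡ code s′ → s ≡ s′
    code-injective (v , p) (v′ , p′) eq with Fin.combine-injective v p v′ p′ eq
    ... | refl , refl = refl

    shift : ∀ d {i j} → σ i ≡ σ j → σ (d ℕ.+ i) ≡ σ (d ℕ.+ j)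
    shift zero    eq = eq
    shift (suc d) eq = cong (step L) (shift d eq)

    collision : ∃₂ λ i j → i ℕ.< j × j ℕ.≤ size × σ i ≡ σ j
    collision with Fin.pigeonhole (ℕ.n<1+n size) (λ t → code (σ (toℕ t)))
    ... | i , j , i<j , eq =
      toℕ i , toℕ j , i<j , ℕ.s≤s⁻¹ (Fin.toℕ<n j) , code-injective _ _ eq

    bounded : ∀ t → ∃ λ s → s ℕ.< suc size × σ s ≡ σ t
    bounded = ℕ.<-rec _ go
      where
      go : ∀ t → (∀ {s} → s ℕ.< t → ∃ λ r → r ℕ.< suc size × σ r ≡ σ s) →
           ∃ λ s → s ℕ.< suc size × σ s ≡ σ t
      go t rec with t ℕ.<? suc size | collision
      ... | yes t<  | _ = t , t< , refl
      ... | no  t≮  | i , j , i<j , j≤ , eq =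
        let j≤t = ℕ.≤-trans j≤ (ℕ.≤-trans (ℕ.n≤1+n size) (ℕ.≮⇒≥ t≮))
            r , r< , eq′ = rec {(t ∸ j) ℕ.+ i}
              (ℕ.<-≤-trans (ℕ.+-monoʳ-< (t ∸ j) i<j) (ℕ.≤-reflexive (ℕ.m∸n+n≡m j≤t)))
        in r , r< , trans eq′ (trans (shift (t ∸ j) eq) (cong σ (ℕ.m∸n+n≡m j≤t)))

  visited? : ∀ w → Dec (Visited L v₀ ℓ w)
  visited? w = map′
    (λ { (t , eq) → toℕ t , eq })
    (λ { (t , eq) → let s , s< , eq′ = bounded t in
         fromℕ< s< , trans (cong (proj₁ ∘ σ) (Fin.toℕ-fromℕ< s<)) (trans (cong proj₁ eq′) eq) })
    (Fin.any? {n = suc size} λ t → basicWalk L v₀ ℓ (toℕ t) Fin.≟ w)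

  numVisited : ℕ
  numVisited = length (filter visited? (allFin n))

uniformMean : ∀ {A : Set} (xs : List A) .{{_ : ℕ.NonZero (length xs)}} → (A → ℕ) → ℚ
uniformMean xs f = + sum (map f xs) / length xs

-- Independent uniform bijections at the vertices amount to a uniformly
-- random element of the set of all labelings, which `labelings n` lists
-- without repetition.
𝔼[V] : (n : ℕ) → Vertex n → Port n → ℚ
𝔼[V] n v₀ ℓ = uniformMean (labelings n) {{labelings-nonEmpty n}} (λ L → numVisited L v₀ ℓ)

{-# OPTIONS --safe #-}
module Submission where

open import Defs
open import Data.Nat.Base using (ℕ; suc)
open import Data.Integer.Base using (+_)
open import Data.Rational.Base using (1ℚ; _*_; _/_)

open import Data.Nat.Base as ℕ using (zero; _!; z≤n; s≤s)
import Data.Nat.Properties as ℕ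
open import Data.Nat.DivMod using (_%_; m<n⇒m%n≡m; [m+n]%n≡m%n; %-distribˡ-+; m%n%n≡m%n)
open import Data.Nat.ListAction using (sum)
open import Data.Nat.Solver using (module +-*-Solver)
import Data.Integer.Base as ℤ
import Data.Integer.Properties as ℤ
open import Data.Rational.Base as ℚ using (ℚ; 0ℚ; _+_; _-_; -_; _≤_; Positive; toℚᵘ)
import Data.Rational.Properties as ℚ
open import Data.Rational.Solver using () renaming (module +-*-Solver to ℚ-Solver)
import Data.Rational.Unnormalised.Base as ℚᵘ
import Data.Rational.Unnormalised.Properties as ℚᵘ
open import Data.Fin.Base using (Fin; zero; suc; toℕ)
open import Data.Fin.Permutation.Components using (transpose; transpose-inverse)
open import Data.Fin.Properties as Fin using (_≟_)
open import Data.List.Base using (List; []; _∷_; _++_; length; filter; map; allFin; cartesianProduct; lookup)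
open import Data.List.Properties using (length-++; length-map; filter-++; length-tabulate)
open import Data.List.Membership.Propositional using (_∈_)
open import Data.List.Membership.Propositional.Properties using (∈-lookup; ∈-allFin; ∈-filter⁺; ∈-filter⁻; ∈-cartesianProduct⁺; ∈-cartesianProduct⁻; ∈-++⁺ˡ; ∈-++⁺ʳ)
import Data.List.Relation.Unary.All as All
open import Data.List.Relation.Unary.Any using (here; there; index)
open import Data.List.Relation.Unary.Any.Properties using (lookup-index)
open import Data.List.Relation.Unary.AllPairs using (_∷_)
open import Data.List.Relation.Unary.Unique.Propositional using (Unique)
import Data.List.Relation.Unary.Unique.Propositional.Properties as Unique
open import Data.Vec.Base as Vec using (Vec; tabulate)
open import Data.Vec.Properties using (lookup∘tabulate; tabulate∘lookup; tabulate-cong)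
open import Data.Product.Base using (∃; _×_; _,_; proj₁; proj₂)
open import Function.Base using (_∘_)
open import Relation.Nullary using (Dec; yes; no; ¬?; contradiction)
open import Relation.Nullary.Decidable using (map′; dec-true; dec-false)
open import Relation.Unary using (Decidable)
open import Relation.Binary.PropositionalEquality

-- Put m = n - 1. Ports do not repeat during the first m steps, so at each time t < m
-- the walk leaves its current vertex v through a port not yet used there. Swapping, in the
-- row of v, this port with the one leading to an unvisited vertex w does not change the
-- walk up to time t, and lets it discover w at time t + 1. This is an injection from pairs
-- (labeling, unvisited vertex) to pairs (labeling discovering a vertex at time t + 1, port),
-- so the next vertex is new with probability at least E[unvisited] / m. Hence the
-- expected number of unvisited vertices shrinks by the factor 1 - 1/m at every step and
-- is at most m (1 - 1/m)ᵐ ≤ m / e after m steps. The last inequality is proved against each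
-- partial sum Eⱼ of the exponential series, by iterating (1 - h) Eⱼ(x + h) ≤ Eⱼ(x) for h = 1/m.

-- Counting in lists

lookup-injective : ∀ {A : Set} {xs : List A} → Unique xs → ∀ i j → lookup xs i ≡ lookup xs j → i ≡ j
lookup-injective (x# ∷ u) zero    zero    eq = refl
lookup-injective (x# ∷ u) zero    (suc j) eq = contradiction eq (All.lookup x# (∈-lookup j))
lookup-injective (x# ∷ u) (suc i) zero    eq = contradiction (sym eq) (All.lookup x# (∈-lookup i))
lookup-injective (x# ∷ u) (suc i) (suc j) eq = cong suc (lookup-injective u i j eq)

-- A relation takes the place of a function because the image of `x` may be built from the proof
-- that `x` lies in `xs`. Positions in `xs` are sent to positions in `ys`, and since `xs` has no
-- repetitions this map of finite sets is injective.
injection⇒length≤ : ∀ {A B : Set} {xs : List A} {ys : List B} (R : A → B → Set) → Unique xs →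
                    (∀ {x} → x ∈ xs → ∃ λ y → y ∈ ys × R x y) →
                    (∀ {x x′ y} → R x y → R x′ y → x ≡ x′) →
                    length xs ℕ.≤ length ys
injection⇒length≤ {xs = xs} {ys} R u total inj = Fin.injective⇒≤ {f = f} f-injective
  where
  f : Fin (length xs) → Fin (length ys)
  f i = index (proj₁ (proj₂ (total (∈-lookup i))))
  R-f : ∀ i → R (lookup xs i) (lookup ys (f i))
  R-f i = let _ , y∈ , r = total (∈-lookup i) in subst (R (lookup xs i)) (lookup-index y∈) r
  f-injective : ∀ {i j} → f i ≡ f j → i ≡ j
  f-injective {i} {j} eq = lookup-injective u i j
    (inj (R-f i) (subst (λ z → R (lookup xs j) (lookup ys z)) (sym eq) (R-f j)))

⊆⇒length≤ : ∀ {A : Set} {xs ys : List A} → Unique xs → (∀ {x} → x ∈ xs → x ∈ ys) → length xs ℕ.≤ length ys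
⊆⇒length≤ u sub = injection⇒length≤ _≡_ u (λ x∈ → _ , sub x∈ , refl) (λ { refl refl → refl })

length-filter-map : ∀ {A B : Set} {P : B → Set} (P? : Decidable P) (f : A → B) xs →
                    length (filter P? (map f xs)) ≡ length (filter (P? ∘ f) xs)
length-filter-map P? f []       = refl
length-filter-map P? f (x ∷ xs) with P? (f x)
... | yes _ = cong suc (length-filter-map P? f xs)
... | no  _ = length-filter-map P? f xs

-- Turns a total over labelings into a count of pairs, so that two totals can be compared by an
-- injection.
sum-length-filter : ∀ {A B : Set} {P : A × B → Set} (P? : Decidable P) xs ys →
                    sum (map (λ x → length (filter (λ y → P? (x , y)) ys)) xs)
                      ≡ length (filter P? (cartesianProduct xs ys))
sum-length-filter P? []       ys = refl
sum-length-filter P? (x ∷ xs) ys = sym (begin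
  length (filter P? (map (x ,_) ys ++ cartesianProduct xs ys))
    ≡⟨ cong length (filter-++ P? (map (x ,_) ys) _) ⟩
  length (filter P? (map (x ,_) ys) ++ filter P? (cartesianProduct xs ys))
    ≡⟨ length-++ (filter P? (map (x ,_) ys)) ⟩
  length (filter P? (map (x ,_) ys)) ℕ.+ length (filter P? (cartesianProduct xs ys))
    ≡⟨ cong₂ ℕ._+_ (length-filter-map P? (x ,_) ys) (sym (sum-length-filter P? xs ys)) ⟩
  _ ∎)
  where open ≡-Reasoning

length-cartesianProduct : ∀ {A B : Set} (xs : List A) (ys : List B) →
                          length (cartesianProduct xs ys) ≡ length xs ℕ.* length ys
length-cartesianProduct []       ys = refl
length-cartesianProduct (x ∷ xs) ys = trans (length-++ (map (x ,_) ys))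
  (cong₂ ℕ._+_ (length-map (x ,_) ys) (length-cartesianProduct xs ys))

sum-map-mono : ∀ {A : Set} {f g : A → ℕ} → (∀ x → f x ℕ.≤ g x) → ∀ xs → sum (map f xs) ℕ.≤ sum (map g xs)
sum-map-mono f≤g []       = z≤n
sum-map-mono f≤g (x ∷ xs) = ℕ.+-mono-≤ (f≤g x) (sum-map-mono f≤g xs)

sum-map-const : ∀ {A : Set} c (xs : List A) → sum (map (λ _ → c) xs) ≡ length xs ℕ.* c
sum-map-const c []       = refl
sum-map-const c (x ∷ xs) = cong (c ℕ.+_) (sum-map-const c xs)

sum-map-+ : ∀ {A : Set} (f g : A → ℕ) xs →
            sum (map (λ x → f x ℕ.+ g x) xs) ≡ sum (map f xs) ℕ.+ sum (map g xs)
sum-map-+ f g []       = refl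
sum-map-+ f g (x ∷ xs) = trans (cong (f x ℕ.+ g x ℕ.+_) (sum-map-+ f g xs))
  (solve 4 (λ a b c d → (a :+ b) :+ (c :+ d) := (a :+ c) :+ (b :+ d)) refl (f x) (g x) (sum (map f xs)) (sum (map g xs)))
  where open +-*-Solver

sum-map-gain : ∀ {A : Set} {P : A → Set} (P? : Decidable P) {f g : A → ℕ} →
               (∀ x → f x ℕ.≤ g x) → (∀ x → P x → f x ℕ.< g x) →
               ∀ xs → sum (map f xs) ℕ.+ length (filter P? xs) ℕ.≤ sum (map g xs)
sum-map-gain P? f≤g f<g [] = z≤n
sum-map-gain P? {f} {g} f≤g f<g (x ∷ xs) with P? x
... | yes Px = subst (ℕ._≤ g x ℕ.+ sum (map g xs))
  (solve 3 (λ a b c → (con 1 :+ a) :+ (b :+ c) := (a :+ b) :+ (con 1 :+ c)) refl (f x) (sum (map f xs)) (length (filter P? xs)))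
  (ℕ.+-mono-≤ (f<g x Px) (sum-map-gain P? f≤g f<g xs))
  where open +-*-Solver
... | no _ = subst (ℕ._≤ g x ℕ.+ sum (map g xs)) (sym (ℕ.+-assoc (f x) _ _))
  (ℕ.+-mono-≤ (f≤g x) (sum-map-gain P? f≤g f<g xs))

-- Permuting the ports of a labeling

target-ext : ∀ {n} {L L′ : Table n} → (∀ v p → target L v p ≡ target L′ v p) → L ≡ L′
target-ext {n} {L} {L′} eq = vec-ext L L′ λ v → vec-ext _ _ (eq v)
  where
  vec-ext : ∀ {A : Set} {k} (xs ys : Vec A k) → (∀ i → Vec.lookup xs i ≡ Vec.lookup ys i) → xs ≡ ys
  vec-ext xs ys eq = trans (sym (tabulate∘lookup xs)) (trans (tabulate-cong eq) (tabulate∘lookup ys))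

reindex : ∀ {n} → (Vertex n → Port n → Port n) → Table n → Table n
reindex π L = tabulate λ v → tabulate λ p → target L v (π v p)

target-reindex : ∀ {n} π (L : Table n) v p → target (reindex π L) v p ≡ target L v (π v p)
target-reindex π L v p = trans
  (cong (λ row → Vec.lookup row p) (lookup∘tabulate (λ v → tabulate λ p → target L v (π v p)) v))
  (lookup∘tabulate (λ p → target L v (π v p)) p)

-- Reindexing composes contravariantly: at `(v , p)` the double reindexing reads `L` at
-- `π v (ρ v p)`, so this is the composite that has to be the identity.
reindex-inverse : ∀ {n} (π ρ : Vertex n → Port n → Port n) → (∀ v p → π v (ρ v p) ≡ p) →
                  ∀ L → reindex ρ (reindex π L) ≡ L
reindex-inverse π ρ πρ L = target-ext λ v p → trans (target-reindex ρ (reindex π L) v p)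
  (trans (target-reindex π L v (ρ v p)) (cong (target L v) (πρ v p)))

reindex-isLabeling : ∀ {n} (π ρ : Vertex n → Port n → Port n) →
                     (∀ v p → π v (ρ v p) ≡ p) → (∀ v p → ρ v (π v p) ≡ p) →
                     ∀ {L} → IsLabeling L → IsLabeling (reindex π L)
reindex-isLabeling π ρ πρ ρπ {L} labeling v = isLabelingAt
  (λ p eq → loopless (π v p) (trans (sym (target-reindex π L v p)) eq))
  (λ p q eq → trans (sym (ρπ v p)) (trans
    (cong (ρ v) (injective (π v p) (π v q)
      (trans (sym (target-reindex π L v p)) (trans eq (target-reindex π L v q)))))
    (ρπ v q)))
  (λ w w≢v → let p , eq = surjective w w≢v in
    ρ v p , trans (target-reindex π L v (ρ v p)) (trans (cong (target L v) (πρ v p)) eq))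
  where open IsLabelingAt (labeling v)

transpose-left : ∀ {n} (i j : Fin n) → transpose i j i ≡ j
transpose-left i j rewrite dec-true (i ≟ i) refl = refl

transpose-fixed : ∀ {n} (i j : Fin n) {k} → k ≢ i → k ≢ j → transpose i j k ≡ k
transpose-fixed i j {k} k≢i k≢j rewrite dec-false (k ≟ i) k≢i | dec-false (k ≟ j) k≢j = refl

swapAt : ∀ {n} → Vertex n → Port n → Port n → Vertex n → Port n → Port n
swapAt v p q u with u ≟ v
... | yes _ = transpose p q
... | no  _ = λ r → r

swapAt-inverse : ∀ {n} (v : Vertex n) p q u r → swapAt v p q u (swapAt v q p u r) ≡ r
swapAt-inverse v p q u r with u ≟ v
... | yes _ = transpose-inverse p q
... | no  _ = refl

swapAt-left : ∀ {n} (v : Vertex n) p q → swapAt v p q v p ≡ q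
swapAt-left v p q with v ≟ v
... | yes _   = transpose-left p q
... | no  v≢v = contradiction refl v≢v

-- The hypotheses are asymmetric to fit the walk: an earlier port differs from `p` at whatever
-- vertex it was used, but can be told apart from `q` only at `v` itself.
swapAt-fixed : ∀ {n} (v : Vertex n) p q {u r} → r ≢ p → (u ≡ v → r ≢ q) → swapAt v p q u r ≡ r
swapAt-fixed v p q {u} r≢p r≢q with u ≟ v
... | yes u≡v = transpose-fixed p q r≢p (r≢q u≡v)
... | no  _   = refl

-- The port used at time t

-- The ports used depend on the initial port alone and not on the labeling, so they survive every
-- change of the table.
portAt : ∀ {k} → Fin k → ℕ → Fin k
portAt ℓ zero    = ℓ
portAt ℓ (suc t) = nextPort (portAt ℓ t)

proj₂-state : ∀ {n} (L : Table n) v₀ ℓ t → proj₂ (state L v₀ ℓ t) ≡ portAt ℓ t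
proj₂-state L v₀ ℓ zero    = refl
proj₂-state L v₀ ℓ (suc t) = cong nextPort (proj₂-state L v₀ ℓ t)

toℕ-portAt : ∀ {k} (ℓ : Fin (suc k)) t → toℕ (portAt ℓ t) ≡ (toℕ ℓ ℕ.+ t) % suc k
toℕ-portAt {k} ℓ zero = sym (trans (cong (_% suc k) (ℕ.+-identityʳ (toℕ ℓ))) (m<n⇒m%n≡m (Fin.toℕ<n ℓ)))
toℕ-portAt {k} ℓ (suc t) = begin
  toℕ (nextPort (portAt ℓ t))                         ≡⟨ Fin.toℕ-fromℕ< _ ⟩
  suc (toℕ (portAt ℓ t)) % suc k                      ≡⟨ cong (λ x → suc x % suc k) (toℕ-portAt ℓ t) ⟩
  (1 ℕ.+ (toℕ ℓ ℕ.+ t) % suc k) % suc k               ≡⟨ %-distribˡ-+ 1 ((toℕ ℓ ℕ.+ t) % suc k) (suc k) ⟩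
  (1 % suc k ℕ.+ (toℕ ℓ ℕ.+ t) % suc k % suc k) % suc k
    ≡⟨ cong (λ x → (1 % suc k ℕ.+ x) % suc k) (m%n%n≡m%n (toℕ ℓ ℕ.+ t) (suc k)) ⟩
  (1 % suc k ℕ.+ (toℕ ℓ ℕ.+ t) % suc k) % suc k       ≡⟨ %-distribˡ-+ 1 (toℕ ℓ ℕ.+ t) (suc k) ⟨
  (1 ℕ.+ (toℕ ℓ ℕ.+ t)) % suc k                       ≡⟨ cong (_% suc k) (ℕ.+-suc (toℕ ℓ) t) ⟨
  (toℕ ℓ ℕ.+ suc t) % suc k                           ∎
  where open ≡-Reasoning

-- Adding `d ∸ a` to the residue undoes the addition of `a` modulo `d`, and `s` and `t` are their
-- own residues.
+-%-cancelˡ : ∀ a {s t} d .{{_ : ℕ.NonZero d}} → a ℕ.≤ d → s ℕ.< d → t ℕ.< d →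
              (a ℕ.+ s) % d ≡ (a ℕ.+ t) % d → s ≡ t
+-%-cancelˡ a {s} {t} d a≤d s<d t<d eq = trans (recover s s<d)
  (trans (cong (λ x → (x ℕ.+ (d ℕ.∸ a) % d) % d) eq) (sym (recover t t<d)))
  where
  open ≡-Reasoning
  recover : ∀ s → s ℕ.< d → s ≡ ((a ℕ.+ s) % d ℕ.+ (d ℕ.∸ a) % d) % d
  recover s s<d = begin
    s                                          ≡⟨ m<n⇒m%n≡m s<d ⟨
    s % d                                      ≡⟨ [m+n]%n≡m%n s d ⟨
    (s ℕ.+ d) % d                              ≡⟨ cong (λ x → (s ℕ.+ x) % d) (ℕ.m+[n∸m]≡n a≤d) ⟨
    (s ℕ.+ (a ℕ.+ (d ℕ.∸ a))) % d              ≡⟨ cong (_% d) (ℕ.+-assoc s a (d ℕ.∸ a)) ⟨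
    (s ℕ.+ a ℕ.+ (d ℕ.∸ a)) % d                ≡⟨ cong (λ x → (x ℕ.+ (d ℕ.∸ a)) % d) (ℕ.+-comm s a) ⟩
    (a ℕ.+ s ℕ.+ (d ℕ.∸ a)) % d                ≡⟨ %-distribˡ-+ (a ℕ.+ s) (d ℕ.∸ a) d ⟩
    ((a ℕ.+ s) % d ℕ.+ (d ℕ.∸ a) % d) % d      ∎

-- The port advances by one modulo `k` at each step, so none returns within one cycle. This limits
-- the argument to the first `k` steps.
portAt-injective : ∀ {k} (ℓ : Fin k) {s t} → s ℕ.< k → t ℕ.< k → portAt ℓ s ≡ portAt ℓ t → s ≡ t
portAt-injective {suc k} ℓ {s} {t} s<k t<k eq = +-%-cancelˡ (toℕ ℓ) (suc k) (ℕ.<⇒≤ (Fin.toℕ<n ℓ)) s<k t<k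
  (trans (sym (toℕ-portAt ℓ s)) (trans (cong toℕ eq) (toℕ-portAt ℓ t)))

-- The vertices avoided by the walk up to time t

module _ {m} (v₀ : Vertex (suc m)) (ℓ : Port (suc m)) where

  walk : Table (suc m) → ℕ → Vertex (suc m)
  walk L = basicWalk L v₀ ℓ

  walk-suc : ∀ L t → walk L (suc t) ≡ target L (walk L t) (portAt ℓ t)
  walk-suc L t = cong (target L (walk L t)) (proj₂-state L v₀ ℓ t)

  Avoids : Table (suc m) → ℕ → Vertex (suc m) → Set
  Avoids L t w = ∀ s → s ℕ.≤ t → walk L s ≢ w

  avoids? : ∀ L t w → Dec (Avoids L t w)
  avoids? L t w = map′ (λ h s s≤t → h (s≤s s≤t)) (λ h {s} s<1+t → h s (ℕ.s≤s⁻¹ s<1+t))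
    (ℕ.allUpTo? (λ s → ¬? (walk L s ≟ w)) (suc t))

  numAvoided : Table (suc m) → ℕ → ℕ
  numAvoided L t = length (filter (avoids? L t) (allFin (suc m)))

  Fresh : ℕ → Table (suc m) → Set
  Fresh t L = Avoids L t (walk L (suc t))

  fresh? : ∀ t → Decidable (Fresh t)
  fresh? t L = avoids? L t (walk L (suc t))

  numFresh : ℕ → ℕ
  numFresh t = length (filter (fresh? t) (labelings (suc m)))

  totalAvoided : ℕ → ℕ
  totalAvoided t = sum (map (λ L → numAvoided L t) (labelings (suc m)))

  totalVisited : ℕ
  totalVisited = sum (map (λ L → numVisited L v₀ ℓ) (labelings (suc m)))

  private
    avoided-unique : ∀ L t → Unique (filter (avoids? L t) (allFin (suc m)))
    avoided-unique L t = Unique.filter⁺ (avoids? L t) (Unique.allFin⁺ (suc m))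

    ∈-avoided⁺ : ∀ L t {w} → Avoids L t w → w ∈ filter (avoids? L t) (allFin (suc m))
    ∈-avoided⁺ L t h = ∈-filter⁺ (avoids? L t) (∈-allFin _) h

    ∈-avoided⁻ : ∀ L t {w} → w ∈ filter (avoids? L t) (allFin (suc m)) → Avoids L t w
    ∈-avoided⁻ L t w∈ = proj₂ (∈-filter⁻ (avoids? L t) {xs = allFin (suc m)} w∈)

    length-allFin : ∀ n → length (allFin n) ≡ n
    length-allFin n = length-tabulate (λ (i : Fin n) → i)

  -- The start `v₀` is visited at time 0, so it can be put in front of the avoided vertices without
  -- creating a repetition.
  numAvoided-zero : ∀ L → numAvoided L 0 ℕ.≤ m
  numAvoided-zero L = ℕ.s≤s⁻¹ (subst (suc (numAvoided L 0) ℕ.≤_) (length-allFin (suc m))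
    (⊆⇒length≤ {xs = v₀ ∷ filter (avoids? L 0) (allFin (suc m))}
      (All.tabulate (λ w∈ → ∈-avoided⁻ L 0 w∈ 0 z≤n) ∷ avoided-unique L 0)
      (λ {w} _ → ∈-allFin w)))

  numAvoided-antimono : ∀ L t → numAvoided L (suc t) ℕ.≤ numAvoided L t
  numAvoided-antimono L t = ⊆⇒length≤ (avoided-unique L (suc t)) λ w∈ →
    ∈-avoided⁺ L t λ s s≤t → ∈-avoided⁻ L (suc t) w∈ s (ℕ.m≤n⇒m≤1+n s≤t)

  -- The vertex reached at `suc t` was avoided up to `t` and is avoided no longer. In front of the
  -- later list it gives a list without repetitions inside the earlier one.
  numAvoided-fresh : ∀ L t → Fresh t L → numAvoided L (suc t) ℕ.< numAvoided L t
  numAvoided-fresh L t fresh = ⊆⇒length≤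
    (All.tabulate (λ w∈ → ∈-avoided⁻ L (suc t) w∈ (suc t) ℕ.≤-refl) ∷ avoided-unique L (suc t))
    λ { (here refl) → ∈-avoided⁺ L t fresh
      ; (there w∈)  → ∈-avoided⁺ L t λ s s≤t → ∈-avoided⁻ L (suc t) w∈ s (ℕ.m≤n⇒m≤1+n s≤t) }

  -- A vertex that is never visited is avoided up to every `t`. There is only an inequality because
  -- a vertex first visited after `t` is counted on both sides.
  numVisited+numAvoided : ∀ L t → suc m ℕ.≤ numVisited L v₀ ℓ ℕ.+ numAvoided L t
  numVisited+numAvoided L t = subst₂ ℕ._≤_ (length-allFin (suc m)) (length-++ visited)
      (⊆⇒length≤ (Unique.allFin⁺ (suc m)) covered)
    where
    visited = filter (visited? L v₀ ℓ) (allFin (suc m))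
    covered : ∀ {w} → w ∈ allFin (suc m) → w ∈ visited ++ filter (avoids? L t) (allFin (suc m))
    covered {w} w∈ with visited? L v₀ ℓ w
    ... | yes vis = ∈-++⁺ˡ (∈-filter⁺ (visited? L v₀ ℓ) w∈ vis)
    ... | no ¬vis = ∈-++⁺ʳ visited (∈-avoided⁺ L t λ s _ eq → ¬vis (s , eq))

  totalAvoided-zero : totalAvoided 0 ℕ.≤ length (labelings (suc m)) ℕ.* m
  totalAvoided-zero = subst (totalAvoided 0 ℕ.≤_) (sum-map-const m (labelings (suc m)))
    (sum-map-mono numAvoided-zero (labelings (suc m)))

  totalAvoided-suc : ∀ t → totalAvoided (suc t) ℕ.+ numFresh t ℕ.≤ totalAvoided t
  totalAvoided-suc t = sum-map-gain (fresh? t) (λ L → numAvoided-antimono L t)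
    (λ L → numAvoided-fresh L t) (labelings (suc m))

  totalVisited+totalAvoided : ∀ t → length (labelings (suc m)) ℕ.* suc m ℕ.≤ totalVisited ℕ.+ totalAvoided t
  totalVisited+totalAvoided t = subst₂ ℕ._≤_
    (sum-map-const (suc m) (labelings (suc m))) (sum-map-+ (λ L → numVisited L v₀ ℓ) (λ L → numAvoided L t) (labelings (suc m)))
    (sum-map-mono (λ L → numVisited+numAvoided L t) (labelings (suc m)))

  -- Rerouting the walk to an avoided vertex

  reroute : ℕ → Port (suc m) → Table (suc m) → Table (suc m)
  reroute t q L = reindex (swapAt (walk L t) (portAt ℓ t) q) L

  -- Before time t the walk uses neither of the two swapped ports at its time-t
  -- vertex: ports do not repeat within m steps, and port q leads to an avoided vertex.
  state-reroute : ∀ {t} q L → t ℕ.< m → Avoids L t (target L (walk L t) q) →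
                  ∀ s → s ℕ.≤ t → state (reroute t q L) v₀ ℓ s ≡ state L v₀ ℓ s
  state-reroute q L t<m av zero _ = refl
  state-reroute {t} q L t<m av (suc s) s<t = trans
    (cong (step (reroute t q L)) (state-reroute q L t<m av s (ℕ.<⇒≤ s<t)))
    (cong (_, nextPort r) (trans (target-reindex (swapAt (walk L t) (portAt ℓ t) q) L u r) (cong (target L u) (swapAt-fixed (walk L t) (portAt ℓ t) q
      (λ r≡p → ℕ.<⇒≢ s<t (portAt-injective ℓ (ℕ.<-trans s<t t<m) t<m (trans (sym (proj₂-state L v₀ ℓ s)) r≡p)))
      (λ u≡v r≡q → av (suc s) s<t (cong₂ (target L) u≡v r≡q))))))
    where
    u = proj₁ (state L v₀ ℓ s)
    r = proj₂ (state L v₀ ℓ s)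

  walk-reroute : ∀ {t} q L → t ℕ.< m → Avoids L t (target L (walk L t) q) →
                 ∀ s → s ℕ.≤ t → walk (reroute t q L) s ≡ walk L s
  walk-reroute q L t<m av s s≤t = cong proj₁ (state-reroute q L t<m av s s≤t)

  -- At time `t` the rerouted walk still stands at `walk L t`, where the swap makes the current port
  -- lead to the vertex that `q` led to.
  walk-reroute-suc : ∀ {t} q L → t ℕ.< m → Avoids L t (target L (walk L t) q) →
                     walk (reroute t q L) (suc t) ≡ target L (walk L t) q
  walk-reroute-suc {t} q L t<m av = begin
    walk (reroute t q L) (suc t)                                       ≡⟨ walk-suc (reroute t q L) t ⟩
    target (reroute t q L) (walk (reroute t q L) t) (portAt ℓ t)
      ≡⟨ cong (λ v → target (reroute t q L) v (portAt ℓ t)) (walk-reroute q L t<m av t ℕ.≤-refl) ⟩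
    target (reroute t q L) (walk L t) (portAt ℓ t)
      ≡⟨ target-reindex (swapAt (walk L t) (portAt ℓ t) q) L (walk L t) (portAt ℓ t) ⟩
    target L (walk L t) (swapAt (walk L t) (portAt ℓ t) q (walk L t) (portAt ℓ t))
      ≡⟨ cong (target L (walk L t)) (swapAt-left (walk L t) (portAt ℓ t) q) ⟩
    target L (walk L t) q                                              ∎
    where open ≡-Reasoning

  -- Rerouting the walk at time t to an avoided vertex w maps the pairs (L , w)
  -- injectively to pairs of a fresh labeling and the port that led to w.
  totalAvoided≤m*numFresh : ∀ {t} → t ℕ.< m → totalAvoided t ℕ.≤ numFresh t ℕ.* m
  totalAvoided≤m*numFresh {t} t<m = subst₂ ℕ._≤_
      (sym (sum-length-filter avoided? labels (allFin (suc m))))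
      (trans (length-cartesianProduct (filter (fresh? t) labels) (allFin m)) (cong (numFresh t ℕ.*_) (length-allFin m)))
      (injection⇒length≤ Reroutes
        (Unique.filter⁺ avoided? (Unique.cartesianProduct⁺ (labelings-unique (suc m)) (Unique.allFin⁺ (suc m))))
        total deterministic)
    where
    labels = labelings (suc m)
    avoided? : Decidable (λ ((L , w) : Table (suc m) × Vertex (suc m)) → Avoids L t w)
    avoided? (L , w) = avoids? L t w
    Reroutes : Table (suc m) × Vertex (suc m) → Table (suc m) × Port (suc m) → Set
    Reroutes (L , w) (L′ , q) = L′ ≡ reroute t q L × target L (walk L t) q ≡ w × Avoids L t w
    total : ∀ {x} → x ∈ filter avoided? (cartesianProduct labels (allFin (suc m))) →
            ∃ λ y → y ∈ cartesianProduct (filter (fresh? t) labels) (allFin m) × Reroutes x y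
    total {L , w} x∈ =
        (reroute t q L , q)
      , ∈-cartesianProduct⁺ (∈-filter⁺ (fresh? t) (labelings-complete _ labeling′) fresh) (∈-allFin q)
      , refl , eq , av
      where
      x∈′ = ∈-filter⁻ avoided? {xs = cartesianProduct labels (allFin (suc m))} x∈
      av : Avoids L t w
      av = proj₂ x∈′
      labeling : IsLabeling L
      labeling = labelings-sound (proj₁ (∈-cartesianProduct⁻ labels (allFin (suc m)) (proj₁ x∈′)))
      -- The vertex `w` is avoided at time `t` itself, so it is not the current vertex and some port
      -- leads to it.
      port = IsLabelingAt.surjective (labeling (walk L t)) w (λ eq → av t ℕ.≤-refl (sym eq))
      q = proj₁ port
      eq = proj₂ port
      av′ : Avoids L t (target L (walk L t) q)
      av′ = subst (Avoids L t) (sym eq) av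
      labeling′ : IsLabeling (reroute t q L)
      labeling′ = reindex-isLabeling (swapAt (walk L t) (portAt ℓ t) q) (swapAt (walk L t) q (portAt ℓ t))
        (swapAt-inverse _ _ _) (swapAt-inverse _ _ _) labeling
      fresh : Fresh t (reroute t q L)
      fresh s s≤t eq′ = av′ s s≤t
        (trans (sym (walk-reroute q L t<m av′ s s≤t)) (trans eq′ (walk-reroute-suc q L t<m av′)))
    -- The image `(L′ , q)` determines its origin. The walks of `L` and `L′` agree up to time `t`,
    -- so the altered row is that of `walk L′ t`, and swapping `q` with `portAt ℓ t` there restores
    -- `L`. The vertex `w` is the one that the walk of `L′` reaches at time `suc t`.
    deterministic : ∀ {x x′ y} → Reroutes x y → Reroutes x′ y → x ≡ x′
    deterministic {L , _} {L₁ , _} {L′ , q} (eq , refl , av) (eq₁ , refl , av₁) = cong₂ _,_ L≡L₁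
        (trans (sym (walk-reroute-suc q L t<m av))
          (trans (cong (λ M → walk M (suc t)) (trans (sym eq) eq₁)) (walk-reroute-suc q L₁ t<m av₁)))
      where
      undo : Vertex (suc m) → Table (suc m) → Table (suc m)
      undo v = reindex (swapAt v q (portAt ℓ t))
      undo-reroute : ∀ M → L′ ≡ reroute t q M → Avoids M t (target M (walk M t) q) → undo (walk L′ t) L′ ≡ M
      undo-reroute M refl av = trans
        (cong (λ v → undo v (reroute t q M)) (walk-reroute q M t<m av t ℕ.≤-refl))
        (reindex-inverse (swapAt (walk M t) (portAt ℓ t) q) (swapAt (walk M t) q (portAt ℓ t))
          (swapAt-inverse (walk M t) (portAt ℓ t) q) M)
      L≡L₁ : L ≡ L₁
      L≡L₁ = trans (sym (undo-reroute L eq av)) (undo-reroute L₁ eq₁ av₁)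

-- Geometric decay of the number of avoided vertices

module _ {p} (v₀ : Vertex (suc (suc p))) (ℓ : Port (suc (suc p))) where

  private
    m = suc p
    A = totalAvoided v₀ ℓ
    N = length (labelings (suc m))

  -- The total drops by at least the number of fresh labelings, which is at least `A t` divided by
  -- `m`; hence the factor 1 - 1/m = p/m. Adding `A t` to both sides avoids subtraction, as
  -- `m ℕ.* A t` computes to `A t ℕ.+ p ℕ.* A t`.
  totalAvoided-decay : ∀ {t} → t ℕ.< m → m ℕ.* A (suc t) ℕ.≤ p ℕ.* A t
  totalAvoided-decay {t} t<m = ℕ.+-cancelˡ-≤ (A t) _ _ (begin
    A t ℕ.+ m ℕ.* A (suc t)         ≤⟨ ℕ.+-monoˡ-≤ _ (totalAvoided≤m*numFresh v₀ ℓ t<m) ⟩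
    F ℕ.* m ℕ.+ m ℕ.* A (suc t)     ≡⟨ solve 3 (λ f m a → f :* m :+ m :* a := m :* (a :+ f)) refl F m (A (suc t)) ⟩
    m ℕ.* (A (suc t) ℕ.+ F)         ≤⟨ ℕ.*-monoʳ-≤ m (totalAvoided-suc v₀ ℓ t) ⟩
    m ℕ.* A t                       ∎)
    where
    open ℕ.≤-Reasoning
    open +-*-Solver
    F = numFresh v₀ ℓ t

  totalAvoided-bound : ∀ t → t ℕ.≤ m → m ℕ.^ t ℕ.* A t ℕ.≤ p ℕ.^ t ℕ.* (N ℕ.* m)
  totalAvoided-bound zero    _   = ℕ.*-monoʳ-≤ 1 (totalAvoided-zero v₀ ℓ)
  totalAvoided-bound (suc t) t<m = begin
    m ℕ.* m ℕ.^ t ℕ.* A (suc t)        ≡⟨ solve 3 (λ x y z → x :* y :* z := y :* (x :* z)) refl m (m ℕ.^ t) (A (suc t)) ⟩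
    m ℕ.^ t ℕ.* (m ℕ.* A (suc t))      ≤⟨ ℕ.*-monoʳ-≤ (m ℕ.^ t) (totalAvoided-decay t<m) ⟩
    m ℕ.^ t ℕ.* (p ℕ.* A t)            ≡⟨ solve 3 (λ x y z → x :* (y :* z) := y :* (x :* z)) refl (m ℕ.^ t) p (A t) ⟩
    p ℕ.* (m ℕ.^ t ℕ.* A t)            ≤⟨ ℕ.*-monoʳ-≤ p (totalAvoided-bound t (ℕ.<⇒≤ t<m)) ⟩
    p ℕ.* (p ℕ.^ t ℕ.* (N ℕ.* m))      ≡⟨ ℕ.*-assoc p (p ℕ.^ t) _ ⟨
    p ℕ.* p ℕ.^ t ℕ.* (N ℕ.* m)        ∎
    where
    open ℕ.≤-Reasoning
    open +-*-Solver

-- The inequality (1 - 1/m)ᵐ e ≤ 1, with m = p + 1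

-- j! mʲ Σ_{k ≤ j} (i/m)ᵏ / k!
scaledExp : ℕ → ℕ → ℕ → ℕ
scaledExp m zero    i = 1
scaledExp m (suc j) i = suc j ℕ.* m ℕ.* scaledExp m j i ℕ.+ i ℕ.^ suc j

-- A mean value bound: the increment of the power is at most its derivative at the right endpoint.
suc-^≤ : ∀ i k → suc i ℕ.^ suc k ℕ.≤ i ℕ.^ suc k ℕ.+ suc k ℕ.* suc i ℕ.^ k
suc-^≤ i zero = ℕ.≤-reflexive (solve 1 (λ i → (con 1 :+ i) :* con 1 := i :* con 1 :+ con 1) refl i)
  where open +-*-Solver
suc-^≤ i (suc k) = begin
  a ℕ.+ i ℕ.* a
    ≤⟨ ℕ.+-monoʳ-≤ a (ℕ.*-monoʳ-≤ i (suc-^≤ i k)) ⟩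
  a ℕ.+ i ℕ.* (b ℕ.+ suc k ℕ.* c)
    ≡⟨ solve 5 (λ a b c i k → a :+ i :* (b :+ k :* c) := i :* b :+ (a :+ k :* (i :* c))) refl a b c i (suc k) ⟩
  i ℕ.* b ℕ.+ (a ℕ.+ suc k ℕ.* (i ℕ.* c))
    ≤⟨ ℕ.+-monoʳ-≤ (i ℕ.* b) (ℕ.+-monoʳ-≤ a (ℕ.*-monoʳ-≤ (suc k) (ℕ.*-monoˡ-≤ c (ℕ.n≤1+n i)))) ⟩
  i ℕ.* b ℕ.+ (a ℕ.+ suc k ℕ.* a)
    ∎
  where
  open ℕ.≤-Reasoning
  open +-*-Solver
  a = suc i ℕ.^ suc k
  b = i ℕ.^ suc k
  c = suc i ℕ.^ k

-- With x = i/m and h = 1/m this is Eⱼ₊₁(x + h) ≤ Eⱼ₊₁(x) + h Eⱼ(x + h), multiplied by (j + 1)!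
-- mʲ⁺¹. It reflects that Eⱼ is the derivative of Eⱼ₊₁, and follows term by term from `suc-^≤`.
scaledExp-suc≤ : ∀ m j i → scaledExp m (suc j) (suc i) ℕ.≤ scaledExp m (suc j) i ℕ.+ suc j ℕ.* scaledExp m j (suc i)
scaledExp-suc≤ m zero i = ℕ.≤-reflexive
  (solve 2 (λ m i → con 1 :* m :* con 1 :+ (con 1 :+ i) :* con 1 := (con 1 :* m :* con 1 :+ i :* con 1) :+ con 1 :* con 1) refl m i)
  where open +-*-Solver
scaledExp-suc≤ m (suc j) i = begin
  d ℕ.* m ℕ.* scaledExp m (suc j) (suc i) ℕ.+ suc i ℕ.^ d
    ≤⟨ ℕ.+-mono-≤ (ℕ.*-monoʳ-≤ (d ℕ.* m) (scaledExp-suc≤ m j i)) (suc-^≤ i (suc j)) ⟩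
  d ℕ.* m ℕ.* (x ℕ.+ suc j ℕ.* y) ℕ.+ (i ℕ.^ d ℕ.+ d ℕ.* suc i ℕ.^ suc j)
    ≡⟨ solve 7 (λ d m x j y a b → d :* m :* (x :+ j :* y) :+ (a :+ d :* b) := (d :* m :* x :+ a) :+ d :* (j :* m :* y :+ b)) refl
         d m x (suc j) y (i ℕ.^ d) (suc i ℕ.^ suc j) ⟩
  scaledExp m d i ℕ.+ d ℕ.* scaledExp m (suc j) (suc i)
    ∎
  where
  open ℕ.≤-Reasoning
  open +-*-Solver
  d = suc (suc j)
  x = scaledExp m (suc j) i
  y = scaledExp m j (suc i)

-- This is (1 - h) Eⱼ(x + h) ≤ Eⱼ(x) with denominators cleared. In the previous bound, the lower
-- partial sum at x + h is replaced by the larger next one, which is then moved to the left;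
-- `m ℕ.* y` computes to `y ℕ.+ p ℕ.* y`.
scaledExp-decay : ∀ p j i → p ℕ.* scaledExp (suc p) j (suc i) ℕ.≤ suc p ℕ.* scaledExp (suc p) j i
scaledExp-decay p zero    i = ℕ.*-monoˡ-≤ 1 (ℕ.n≤1+n p)
scaledExp-decay p (suc j) i = ℕ.+-cancelˡ-≤ y _ _ (begin
  m ℕ.* y                                      ≤⟨ ℕ.*-monoʳ-≤ m (scaledExp-suc≤ m j i) ⟩
  m ℕ.* (x ℕ.+ suc j ℕ.* scaledExp m j (suc i))
    ≡⟨ solve 4 (λ m x j z → m :* (x :+ j :* z) := j :* m :* z :+ m :* x) refl m x (suc j) (scaledExp m j (suc i)) ⟩
  suc j ℕ.* m ℕ.* scaledExp m j (suc i) ℕ.+ m ℕ.* x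
    ≤⟨ ℕ.+-monoˡ-≤ (m ℕ.* x) (ℕ.m≤m+n (suc j ℕ.* m ℕ.* scaledExp m j (suc i)) (suc i ℕ.^ suc j)) ⟩
  y ℕ.+ m ℕ.* x                                ∎)
  where
  open ℕ.≤-Reasoning
  open +-*-Solver
  m = suc p
  x = scaledExp m (suc j) i
  y = scaledExp m (suc j) (suc i)

scaledExp-zero : ∀ m j → scaledExp m j 0 ≡ m ℕ.^ j ℕ.* j !
scaledExp-zero m zero    = refl
scaledExp-zero m (suc j) = trans (cong (λ x → suc j ℕ.* m ℕ.* x ℕ.+ 0) (scaledExp-zero m j))
  (solve 4 (λ j m a b → j :* m :* (a :* b) :+ con 0 := m :* a :* (j :* b)) refl (suc j) m (m ℕ.^ j) (j !))
  where open +-*-Solver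

-- Iterating the decay from x = 0, where Eⱼ is 1, gives (1 - h)ⁱ Eⱼ(i h) ≤ 1.
scaledExp-^≤ : ∀ p j i → p ℕ.^ i ℕ.* scaledExp (suc p) j i ℕ.≤ suc p ℕ.^ i ℕ.* (suc p ℕ.^ j ℕ.* j !)
scaledExp-^≤ p j zero    = ℕ.*-monoʳ-≤ 1 (ℕ.≤-reflexive (scaledExp-zero (suc p) j))
scaledExp-^≤ p j (suc i) = begin
  p ℕ.* p ℕ.^ i ℕ.* scaledExp m j (suc i)        ≡⟨ solve 3 (λ x y z → x :* y :* z := y :* (x :* z)) refl p (p ℕ.^ i) (scaledExp m j (suc i)) ⟩
  p ℕ.^ i ℕ.* (p ℕ.* scaledExp m j (suc i))      ≤⟨ ℕ.*-monoʳ-≤ (p ℕ.^ i) (scaledExp-decay p j i) ⟩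
  p ℕ.^ i ℕ.* (m ℕ.* scaledExp m j i)            ≡⟨ solve 3 (λ x y z → x :* (y :* z) := y :* (x :* z)) refl (p ℕ.^ i) m (scaledExp m j i) ⟩
  m ℕ.* (p ℕ.^ i ℕ.* scaledExp m j i)            ≤⟨ ℕ.*-monoʳ-≤ m (scaledExp-^≤ p j i) ⟩
  m ℕ.* (m ℕ.^ i ℕ.* (m ℕ.^ j ℕ.* j !))          ≡⟨ ℕ.*-assoc m (m ℕ.^ i) _ ⟨
  m ℕ.* m ℕ.^ i ℕ.* (m ℕ.^ j ℕ.* j !)            ∎
  where
  open ℕ.≤-Reasoning
  open +-*-Solver
  m = suc p

-- j! Σ_{k ≤ j} 1/k!
arrangements : ℕ → ℕ
arrangements zero    = 1
arrangements (suc j) = suc j ℕ.* arrangements j ℕ.+ 1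

scaledExp-diagonal : ∀ m j → scaledExp m j m ≡ m ℕ.^ j ℕ.* arrangements j
scaledExp-diagonal m zero    = refl
scaledExp-diagonal m (suc j) = trans (cong (λ x → suc j ℕ.* m ℕ.* x ℕ.+ m ℕ.* m ℕ.^ j) (scaledExp-diagonal m j))
  (solve 4 (λ j m a b → j :* m :* (a :* b) :+ m :* a := m :* a :* (j :* b :+ con 1)) refl (suc j) m (m ℕ.^ j) (arrangements j))
  where open +-*-Solver

-- The case i = m, where the exponential sum is evaluated at 1: (1 - 1/m)ᵐ Eⱼ ≤ 1. The scaling
-- factor mʲ cancels.
^*arrangements≤ : ∀ p j → p ℕ.^ suc p ℕ.* arrangements j ℕ.≤ suc p ℕ.^ suc p ℕ.* j !
^*arrangements≤ p j = ℕ.*-cancelˡ-≤ (m ℕ.^ j) {{ℕ.m^n≢0 m j}} (begin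
  m ℕ.^ j ℕ.* (p ℕ.^ m ℕ.* arrangements j)   ≡⟨ swap (m ℕ.^ j) (p ℕ.^ m) (arrangements j) ⟩
  p ℕ.^ m ℕ.* (m ℕ.^ j ℕ.* arrangements j)   ≡⟨ cong (p ℕ.^ m ℕ.*_) (scaledExp-diagonal m j) ⟨
  p ℕ.^ m ℕ.* scaledExp m j m                ≤⟨ scaledExp-^≤ p j m ⟩
  m ℕ.^ m ℕ.* (m ℕ.^ j ℕ.* j !)              ≡⟨ swap (m ℕ.^ m) (m ℕ.^ j) (j !) ⟩
  m ℕ.^ j ℕ.* (m ℕ.^ m ℕ.* j !)              ∎)
  where
  open ℕ.≤-Reasoning
  m = suc p
  swap : ∀ a b c → a ℕ.* (b ℕ.* c) ≡ b ℕ.* (a ℕ.* c)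
  swap = solve 3 (λ a b c → a :* (b :* c) := b :* (a :* c)) refl
    where open +-*-Solver

totalAvoided*arrangements≤ : ∀ {p} (v₀ : Vertex (suc (suc p))) (ℓ : Port (suc (suc p))) j →
  totalAvoided v₀ ℓ (suc p) ℕ.* arrangements j ℕ.≤ length (labelings (suc (suc p))) ℕ.* suc (suc p) ℕ.* j !
totalAvoided*arrangements≤ {p} v₀ ℓ j = ℕ.*-cancelˡ-≤ (m ℕ.^ m) {{ℕ.m^n≢0 m m}} (begin
  m ℕ.^ m ℕ.* (A ℕ.* H)                  ≡⟨ ℕ.*-assoc (m ℕ.^ m) A H ⟨
  m ℕ.^ m ℕ.* A ℕ.* H                    ≤⟨ ℕ.*-monoˡ-≤ H (totalAvoided-bound v₀ ℓ m ℕ.≤-refl) ⟩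
  p ℕ.^ m ℕ.* (N ℕ.* m) ℕ.* H            ≡⟨ solve 3 (λ a b c → a :* b :* c := b :* (a :* c)) refl (p ℕ.^ m) (N ℕ.* m) H ⟩
  -- The factor `m` is weakened to the number of vertices `suc m`, by which the expectation is
  -- finally divided.
  N ℕ.* m ℕ.* (p ℕ.^ m ℕ.* H)            ≤⟨ ℕ.*-mono-≤ (ℕ.*-monoʳ-≤ N (ℕ.n≤1+n m)) (^*arrangements≤ p j) ⟩
  N ℕ.* suc m ℕ.* (m ℕ.^ m ℕ.* j !)      ≡⟨ solve 3 (λ a b c → a :* (b :* c) := b :* (a :* c)) refl (N ℕ.* suc m) (m ℕ.^ m) (j !) ⟩
  m ℕ.^ m ℕ.* (N ℕ.* suc m ℕ.* j !)      ∎)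
  where
  open ℕ.≤-Reasoning
  open +-*-Solver
  m = suc p
  A = totalAvoided v₀ ℓ m
  N = length (labelings (suc m))
  H = arrangements j

-- From counts to the expectation

ι : ℕ → ℚ
ι a = + a / 1

private
  toℚᵘ-/ : ∀ a b → toℚᵘ (+ a / suc b) ℚᵘ.≃ ℚᵘ.mkℚᵘ (+ a) b
  toℚᵘ-/ a b = ℚ.toℚᵘ-fromℚᵘ (ℚᵘ.mkℚᵘ (+ a) b)

ι-+ : ∀ a b → ι (a ℕ.+ b) ≡ ι a + ι b
ι-+ a b = ℚ.toℚᵘ-injective (begin
  toℚᵘ (ι (a ℕ.+ b))                               ≈⟨ toℚᵘ-/ (a ℕ.+ b) 0 ⟩
  ℚᵘ.mkℚᵘ (+ (a ℕ.+ b)) 0                          ≈⟨ ℚᵘ.*≡* (cong (ℤ._* + 1) (trans (ℤ.pos-+ a b) (sym (cong₂ ℤ._+_ (ℤ.*-identityʳ (+ a)) (ℤ.*-identityʳ (+ b)))))) ⟩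
  ℚᵘ.mkℚᵘ (+ a) 0 ℚᵘ.+ ℚᵘ.mkℚᵘ (+ b) 0             ≈⟨ ℚᵘ.+-cong (toℚᵘ-/ a 0) (toℚᵘ-/ b 0) ⟨
  toℚᵘ (ι a) ℚᵘ.+ toℚᵘ (ι b)                       ≈⟨ ℚ.toℚᵘ-homo-+ (ι a) (ι b) ⟨
  toℚᵘ (ι a + ι b)                                 ∎)
  where open ℚᵘ.≃-Reasoning

ι-* : ∀ a b → ι (a ℕ.* b) ≡ ι a * ι b
ι-* a b = ℚ.toℚᵘ-injective (begin
  toℚᵘ (ι (a ℕ.* b))                               ≈⟨ toℚᵘ-/ (a ℕ.* b) 0 ⟩
  ℚᵘ.mkℚᵘ (+ (a ℕ.* b)) 0                          ≈⟨ ℚᵘ.*≡* (cong (ℤ._* + 1) (ℤ.pos-* a b)) ⟩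
  ℚᵘ.mkℚᵘ (+ a) 0 ℚᵘ.* ℚᵘ.mkℚᵘ (+ b) 0             ≈⟨ ℚᵘ.*-cong (toℚᵘ-/ a 0) (toℚᵘ-/ b 0) ⟨
  toℚᵘ (ι a) ℚᵘ.* toℚᵘ (ι b)                       ≈⟨ ℚ.toℚᵘ-homo-* (ι a) (ι b) ⟨
  toℚᵘ (ι a * ι b)                                 ∎)
  where open ℚᵘ.≃-Reasoning

/*ι : ∀ a b .{{_ : ℕ.NonZero b}} → (+ a / b) * ι b ≡ ι a
/*ι a (suc b) = ℚ.toℚᵘ-injective (begin
  toℚᵘ ((+ a / suc b) * ι (suc b))                 ≈⟨ ℚ.toℚᵘ-homo-* (+ a / suc b) (ι (suc b)) ⟩
  toℚᵘ (+ a / suc b) ℚᵘ.* toℚᵘ (ι (suc b))         ≈⟨ ℚᵘ.*-cong (toℚᵘ-/ a b) (toℚᵘ-/ (suc b) 0) ⟩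
  ℚᵘ.mkℚᵘ (+ a) b ℚᵘ.* ℚᵘ.mkℚᵘ (+ suc b) 0         ≈⟨ ℚᵘ.*≡* (ℤ.*-assoc (+ a) (+ suc b) (+ 1)) ⟩
  ℚᵘ.mkℚᵘ (+ a) 0                                  ≈⟨ toℚᵘ-/ a 0 ⟨
  toℚᵘ (ι a)                                       ∎)
  where open ℚᵘ.≃-Reasoning

ι-mono-≤ : ∀ {a b} → a ℕ.≤ b → ι a ≤ ι b
ι-mono-≤ {a} {b} a≤b = ℚ.toℚᵘ-cancel-≤ (begin
  toℚᵘ (ι a)         ≃⟨ toℚᵘ-/ a 0 ⟩
  ℚᵘ.mkℚᵘ (+ a) 0    ≤⟨ ℚᵘ.*≤* (ℤ.*-monoʳ-≤-nonNeg (+ 1) (ℤ.+≤+ a≤b)) ⟩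
  ℚᵘ.mkℚᵘ (+ b) 0    ≃⟨ toℚᵘ-/ b 0 ⟨
  toℚᵘ (ι b)         ∎)
  where open ℚᵘ.≤-Reasoning

ι-positive : ∀ a .{{_ : ℕ.NonZero a}} → Positive (ι a)
ι-positive a = ℚ.normalize-pos a 1

expSum*! : ∀ j → expSum j * ι (j !) ≡ ι (arrangements j)
expSum*! zero    = refl
expSum*! (suc j) = begin
  (expSum j + 1/! (suc j)) * ι (suc j !)
    ≡⟨ ℚ.*-distribʳ-+ (ι (suc j !)) (expSum j) (1/! (suc j)) ⟩
  expSum j * ι (suc j !) + 1/! (suc j) * ι (suc j !)
    ≡⟨ cong₂ _+_ (cong (expSum j *_) (trans (cong ι (ℕ.*-comm (suc j) (j !))) (ι-* (j !) (suc j))))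
                 (/*ι 1 (suc j !) {{suc j ℕ.!≢0}}) ⟩
  expSum j * (ι (j !) * ι (suc j)) + ι 1
    ≡⟨ cong (_+ ι 1) (ℚ.*-assoc (expSum j) (ι (j !)) (ι (suc j))) ⟨
  expSum j * ι (j !) * ι (suc j) + ι 1
    ≡⟨ cong (λ x → x * ι (suc j) + ι 1) (expSum*! j) ⟩
  ι (arrangements j) * ι (suc j) + ι 1
    ≡⟨ cong (_+ ι 1) (trans (sym (ι-* (arrangements j) (suc j))) (cong ι (ℕ.*-comm (arrangements j) (suc j)))) ⟩
  ι (suc j ℕ.* arrangements j) + ι 1
    ≡⟨ ι-+ (suc j ℕ.* arrangements j) 1 ⟨
  ι (suc j ℕ.* arrangements j ℕ.+ 1)
    ∎
  where open ≡-Reasoning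

-- Multiplied by `N ℕ.* n` this says that visited and avoided vertices together cover all vertices
-- in every labeling, the avoided ones after `suc p` steps being at most `N ℕ.* n` over Eⱼ. There is
-- no error term in n.
1≤𝔼[V]/n+1/expSum : ∀ {p} (v₀ : Vertex (suc (suc p))) (ℓ : Port (suc (suc p))) j →
  1ℚ ≤ 𝔼[V] (suc (suc p)) v₀ ℓ * (+ 1 / suc (suc p)) + recip (expSum j) (1≤expSum j)
1≤𝔼[V]/n+1/expSum {p} v₀ ℓ j = ℚ.*-cancelʳ-≤-pos (ι (N ℕ.* n)) {{ι-positive (N ℕ.* n) {{ℕ.m*n≢0 N n}}}} (begin
  1ℚ * ι (N ℕ.* n)                                ≡⟨ ℚ.*-identityˡ _ ⟩
  ι (N ℕ.* n)                                     ≤⟨ ι-mono-≤ (totalVisited+totalAvoided v₀ ℓ (suc p)) ⟩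
  ι (V ℕ.+ A)                                     ≡⟨ ι-+ V A ⟩
  ι V + ι A                                       ≤⟨ ℚ.+-mono-≤ (ℚ.≤-reflexive (sym x*Nn)) A≤ ⟩
  x * ι (N ℕ.* n) + r * ι (N ℕ.* n)               ≡⟨ ℚ.*-distribʳ-+ (ι (N ℕ.* n)) x r ⟨
  (x + r) * ι (N ℕ.* n)                           ∎)
  where
  open ℚ.≤-Reasoning
  open ℚ-Solver
  n = suc (suc p)
  N = length (labelings n)
  V = totalVisited v₀ ℓ
  A = totalAvoided v₀ ℓ (suc p)
  E = expSum j
  x = 𝔼[V] n v₀ ℓ * (+ 1 / n)
  r = recip E (1≤expSum j)
  instance
    N≢0 : ℕ.NonZero N
    N≢0 = labelings-nonEmpty n
    E-positive : Positive E
    E-positive = ℚ.positive (ℚ.<-≤-trans (ℚ.positive⁻¹ 1ℚ) (1≤expSum j))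
    E≢0 : ℚ.NonZero E
    E≢0 = ℚ.pos⇒nonZero E
  x*Nn : x * ι (N ℕ.* n) ≡ ι V
  x*Nn = begin-equality
    𝔼[V] n v₀ ℓ * (+ 1 / n) * ι (N ℕ.* n)             ≡⟨ cong (x *_) (ι-* N n) ⟩
    𝔼[V] n v₀ ℓ * (+ 1 / n) * (ι N * ι n)
      ≡⟨ solve 4 (λ a b c d → a :* b :* (c :* d) := (a :* c) :* (b :* d)) refl (𝔼[V] n v₀ ℓ) (+ 1 / n) (ι N) (ι n) ⟩
    𝔼[V] n v₀ ℓ * ι N * ((+ 1 / n) * ι n)             ≡⟨ cong₂ _*_ (/*ι V N) (/*ι 1 n) ⟩
    ι V * 1ℚ                                          ≡⟨ ℚ.*-identityʳ (ι V) ⟩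
    ι V                                               ∎
  A≤ : ι A ≤ r * ι (N ℕ.* n)
  -- Multiplying by `E` and by `j !` clears the denominators, since `r * E` is 1 and `E * ι (j !)`
  -- is the natural number `arrangements j`.
  A≤ = ℚ.*-cancelʳ-≤-pos E (ℚ.*-cancelʳ-≤-pos (ι (j !)) {{ι-positive (j !) {{j ℕ.!≢0}}}} (begin
    ι A * E * ι (j !)                    ≡⟨ ℚ.*-assoc (ι A) E (ι (j !)) ⟩
    ι A * (E * ι (j !))                  ≡⟨ cong (ι A *_) (expSum*! j) ⟩
    ι A * ι (arrangements j)             ≡⟨ ι-* A (arrangements j) ⟨
    ι (A ℕ.* arrangements j)             ≤⟨ ι-mono-≤ (totalAvoided*arrangements≤ v₀ ℓ j) ⟩
    ι (N ℕ.* n ℕ.* j !)                  ≡⟨ ι-* (N ℕ.* n) (j !) ⟩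
    ι (N ℕ.* n) * ι (j !)                ≡⟨ cong (_* ι (j !)) (ℚ.*-identityˡ (ι (N ℕ.* n))) ⟨
    1ℚ * ι (N ℕ.* n) * ι (j !)           ≡⟨ cong (λ y → y * ι (N ℕ.* n) * ι (j !)) (ℚ.*-inverseˡ E) ⟨
    r * E * ι (N ℕ.* n) * ι (j !)        ≡⟨ cong (_* ι (j !)) (solve 3 (λ a b c → a :* b :* c := a :* c :* b) refl r E (ι (N ℕ.* n))) ⟩
    r * ι (N ℕ.* n) * E * ι (j !)        ∎))

theorem5p1 : (v₀ : (k : ℕ) → Vertex (suc (suc k))) (ℓ : (k : ℕ) → Port (suc (suc k))) →
    Liminf (λ k → 𝔼[V] (suc (suc k)) (v₀ k) (ℓ k) * (+ 1 / suc (suc k))) AtLeast (fromℚ 1ℚ -ℝ 1/e)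
-- Both thresholds are 0: the bound holds for every n ≥ 2 and for every approximant of `1/e`, whose
-- entry at `j` is `recip (expSum j) (1≤expSum j)`. Both ε and ε′ are mere slack.
theorem5p1 v₀ ℓ ε 0<ε = 0 , λ k _ ε′ 0<ε′ → 0 , λ j _ →
  let x = 𝔼[V] (suc (suc k)) (v₀ k) (ℓ k) * (+ 1 / suc (suc k))
      r = recip (expSum j) (1≤expSum j)
  in begin
    1ℚ - r - ε          ≤⟨ ℚ.+-mono-≤ (ℚ.+-monoˡ-≤ (- r) (1≤𝔼[V]/n+1/expSum (v₀ k) (ℓ k) j)) (ℚ.neg-antimono-≤ (ℚ.<⇒≤ 0<ε)) ⟩
    x + r - r + 0ℚ      ≤⟨ ℚ.+-monoʳ-≤ (x + r - r) (ℚ.<⇒≤ 0<ε′) ⟩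
    x + r - r + ε′      ≡⟨ cong (_+ ε′) (solve 2 (λ x r → x :+ r :- r := x) refl x r) ⟩
    x + ε′              ∎
  where
  open ℚ.≤-Reasoning
  open ℚ-Solver
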